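{- Let $m\ge 3$ and $n\ge 1$ be integers. The link residual closeness of the lollipop graph $L_{m,n}$ is $$LR(L_{m,n}) = \frac{m(m-1)}{2} + 2n + 2^{2-n} - 4 .$$
   Context: All graphs are finite, simple and undirected. The closeness of a graph $G$ is $C(G)=\sum_{i}\sum_{j\ne i}2^{ -d(i,j)}$, where $i,j$ range over the vertices of $G$ (ordered pairs), $d(i,j)$ is the distance between $i$ and $j$ in $G$, and the term $2^{ -d(i,j)}$ is $0$ if $i$ and $j$ lie in different connected components. The link residual closeness $LR(G)$ of $G$ is the minimum of $C(G')$ over all graphs $G'$ obtained from $G$ by deleting exactly one link (edge), keeping all vertices. The lollipop graph $L_{m,n}$ ($m\ge 3$, $n\ge 1$) has $m+n$ vertices $v_1,\dots,v_{m+n}$: the vertices $v_1,\dots,v_m$ form a complete graph $K_m$, the vertices $v_{m+1},\dots,v_{m+n}$ form a path $P_n$ (with links $(v_{m+i},v_{m+i+1})$, $1\le i\le n-1$), and there is one further link, the bridge $(v_m,v_{m+1})$. -}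

module Defs where

open import Data.Bool.Base using (if_then_else_)
open import Data.Fin.Base using (Fin; zero; suc; toℕ)
import Data.Fin.Base as Fin
open import Data.Fin.Properties using (_≟_; any?; pigeonhole)
open import Data.Integer.Base as ℤ using (ℤ; +_; -[1+_])
open import Data.Nat.Base using (ℕ; zero; suc; _+_; _≤_; _<_; z<s; s<s; s≤s)
import Data.Nat.Properties as ℕ
open import Data.Product.Base using (_×_; _,_; ∃; ∃₂)
open import Data.Rational.Base as ℚ using (ℚ; 0ℚ; ½)
open import Data.Rational.Properties using (+-0-commutativeMonoid; +-*-commutativeRing)
open import Data.Sum.Base using (_⊎_; inj₁; inj₂; swap)
open import Data.Nat.Induction using (<-wellFounded)
open import Induction.WellFounded using (Acc; acc)
open import Algebra.Bundles using (module CommutativeRing)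
open import Algebra.Properties.CommutativeMonoid.Sum +-0-commutativeMonoid using (sum)
open import Algebra.Properties.Semiring.Exp
  (CommutativeRing.semiring +-*-commutativeRing) using (_^_)
open import Function.Base using (case_of_)
open import Relation.Binary.Construct.Closure.Symmetric as Sym using (SymClosure; fwd; bwd)
open import Relation.Binary.Definitions using (Symmetric; Irreflexive; Decidable)
open import Relation.Binary.PropositionalEquality.Core using (_≡_; refl; sym; subst)
open import Relation.Nullary using (¬_; Dec; yes; no; does)
open import Relation.Nullary.Decidable using (_×-dec_; _⊎-dec_; ¬?; map′)
import Relation.Unary as Unary

2^_ : ℤ → ℚ
2^ (+ k)    = (+ 2 ℚ./ 1) ^ k
2^ -[1+ k ] = ½ ^ suc k

infixr 8 2^_

record Graph (N : ℕ) : Set₁ where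
  field
    Adj        : Fin N → Fin N → Set
    adj?       : Decidable Adj
    adj-sym    : Symmetric Adj
    adj-irrefl : Irreflexive _≡_ Adj

open Graph public

module _ {N : ℕ} (G : Graph N) where

  infixr 5 _∷_

  data Walk : Fin N → Fin N → ℕ → Set where
    []  : ∀ {i} → Walk i i 0
    _∷_ : ∀ {i j k l} → Adj G i j → Walk j k l → Walk i k (suc l)

  IsDistance : Fin N → Fin N → ℕ → Set
  IsDistance i j d = Walk i j d × (∀ {l} → Walk i j l → d ≤ l)

  Connected : Fin N → Fin N → Set
  Connected i j = ∃ (Walk i j)

  private
    walk? : ∀ i j l → Dec (Walk i j l)
    walk? i j zero = map′ (λ { refl → [] }) (λ { [] → refl }) (i ≟ j)
    walk? i j (suc l) =
      map′ (λ { (_ , e , w) → e ∷ w }) (λ { (e ∷ w) → _ , e , w })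
           (any? (λ k → adj? G i k ×-dec walk? k j l))

    vertexAt : ∀ {i j l} → Walk i j l → Fin (suc l) → Fin N
    vertexAt {i} w       zero    = i
    vertexAt     (_ ∷ w) (suc a) = vertexAt w a

    dropTo : ∀ {i j l} (w : Walk i j l) a →
             ∃ λ l′ → l′ ≤ l × Walk (vertexAt w a) j l′
    dropTo w       zero    = _ , ℕ.≤-refl , w
    dropTo (_ ∷ w) (suc a) with dropTo w a
    ... | l′ , l′≤l , w′ = l′ , ℕ.m≤n⇒m≤1+n l′≤l , w′

    cut : ∀ {i j l} (w : Walk i j l) (a b : Fin (suc l)) → a Fin.< b →
          vertexAt w a ≡ vertexAt w b → ∃ λ l′ → l′ < l × Walk i j l′
    cut (_ ∷ w) zero (suc b) _ eq with dropTo w b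
    ... | l′ , l′≤l , w′ = l′ , s≤s l′≤l , subst (λ x → Walk x _ l′) (sym eq) w′
    cut (e ∷ w) (suc a) (suc b) (s<s a<b) eq with cut w a b a<b eq
    ... | l′ , l′<l , w′ = suc l′ , s<s l′<l , e ∷ w′

    shorten : ∀ {i j l} → Acc _<_ l → Walk i j l → ∃ λ l′ → l′ < N × Walk i j l′
    shorten {l = l} (acc rec) w with l ℕ.<? N
    ... | yes l<N = l , l<N , w
    ... | no  l≮N with pigeonhole (s≤s (ℕ.≮⇒≥ l≮N)) (vertexAt w)
    ...   | a , b , a<b , eq with cut w a b a<b eq
    ...     | l′ , l′<l , w′ = shorten (rec l′<l) w′

    least : ∀ {P : ℕ → Set} → Unary.Decidable P → ∀ b →
            (∃ λ d → P d × (∀ {l} → P l → d ≤ l)) ⊎ (∀ {l} → l < b → ¬ P l)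
    least P? zero = inj₂ λ ()
    least P? (suc b) with least P? b
    ... | inj₁ found = inj₁ found
    ... | inj₂ none with P? b
    ...   | yes Pb = inj₁ (b , Pb , λ Pl → ℕ.≮⇒≥ (λ l<b → none l<b Pl))
    ...   | no ¬Pb = inj₂ λ { (s≤s l≤b) Pl → case ℕ.m≤n⇒m<n∨m≡n l≤b of λ
      { (inj₁ l<b)  → none l<b Pl
      ; (inj₂ refl) → ¬Pb Pl } }

  distance : ∀ i j → ∃ (IsDistance i j) ⊎ ¬ Connected i j
  distance i j with least (walk? i j) N
  ... | inj₁ found = inj₁ found
  ... | inj₂ none  = inj₂ λ { (l , w) →
          let l′ , l′<N , w′ = shorten (<-wellFounded l) w in none l′<N w′ }

  2^-distance : Fin N → Fin N → ℚ
  2^-distance i j with distance i j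
  ... | inj₁ (d , _) = 2^ (ℤ.- + d)
  ... | inj₂ _       = 0ℚ

  closeness : ℚ
  closeness = sum λ i → sum λ j → if does (i ≟ j) then 0ℚ else 2^-distance i j

deleteLink : ∀ {N} → Graph N → Fin N → Fin N → Graph N
deleteLink {N} G u v = record
  { Adj        = λ x y → Adj G x y × ¬ IsLink x y
  ; adj?       = λ x y → adj? G x y ×-dec
                   ¬? ((x ≟ u ×-dec y ≟ v) ⊎-dec (y ≟ u ×-dec x ≟ v))
  ; adj-sym    = λ { (e , kept) → adj-sym G e , λ l → kept (swap l) }
  ; adj-irrefl = λ { x≡y (e , _) → adj-irrefl G x≡y e }
  }
  where
  IsLink : Fin N → Fin N → Set
  IsLink x y = (x ≡ u × y ≡ v) ⊎ (y ≡ u × x ≡ v)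

-- A relation and not a function, since a graph without links has no such minimum.
IsLinkResidualCloseness : ∀ {N} → Graph N → ℚ → Set
IsLinkResidualCloseness G r =
  (∃₂ λ u v → Adj G u v × r ≡ closeness (deleteLink G u v)) ×
  (∀ u v → Adj G u v → r ℚ.≤ closeness (deleteLink G u v))

-- The index p refers to v_p, so p and q range over 1, …, m + n.
data LollipopLink (m : ℕ) (p q : ℕ) : Set where
  clique : p < q → q ≤ m → LollipopLink m p q
  bridge : p ≡ m → q ≡ suc m → LollipopLink m p q
  path   : m < p → q ≡ suc p → LollipopLink m p q

private
  lollipopLink? : ∀ m → Decidable (LollipopLink m)
  lollipopLink? m p q =
    map′ (λ { (inj₁ (a , b))        → clique a b
            ; (inj₂ (inj₁ (a , b))) → bridge a b
            ; (inj₂ (inj₂ (a , b))) → path a b })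
         (λ { (clique a b) → inj₁ (a , b)
            ; (bridge a b) → inj₂ (inj₁ (a , b))
            ; (path a b)   → inj₂ (inj₂ (a , b)) })
         ((p ℕ.<? q ×-dec q ℕ.≤? m) ⊎-dec
          (p ℕ.≟ m ×-dec q ℕ.≟ suc m) ⊎-dec
          (m ℕ.<? p ×-dec q ℕ.≟ suc p))

  lollipopLink⇒< : ∀ {m p q} → LollipopLink m p q → p < q
  lollipopLink⇒< (clique p<q _)     = p<q
  lollipopLink⇒< (bridge refl refl) = ℕ.≤-refl
  lollipopLink⇒< (path _ refl)      = ℕ.≤-refl

-- The element i of Fin (m + n) is the vertex v_(i+1).
lollipop : (m n : ℕ) → Graph (m + n)
lollipop m n = record
  { Adj        = SymClosure Link
  ; adj?       = λ i j →
      map′ (λ { (inj₁ l) → fwd l ; (inj₂ l) → bwd l })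
           (λ { (fwd l) → inj₁ l ; (bwd l) → inj₂ l })
           (link? i j ⊎-dec link? j i)
  ; adj-sym    = Sym.symmetric Link
  ; adj-irrefl = λ { refl (fwd l) → ℕ.<-irrefl refl (lollipopLink⇒< l)
                   ; refl (bwd l) → ℕ.<-irrefl refl (lollipopLink⇒< l) }
  }
  where
  Link : Fin (m + n) → Fin (m + n) → Set
  Link i j = LollipopLink m (suc (toℕ i)) (suc (toℕ j))

  link? : Decidable Link
  link? i j = lollipopLink? m (suc (toℕ i)) (suc (toℕ j))

{-# OPTIONS --safe #-}

-- Deleting the bridge leaves K_m and P_n, so the value is the sum of their
-- closenesses.  Any other deletion is at least as good, by exhibiting walks:
-- cutting the tail after k of its vertices leaves P_k, P_(n-k) and, as m ≥ 3,
-- an ordered-pair sum of at least 2 (2 - 2^(1-k)) between K_m and P_k; with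
-- C(P_k) = 2k + 2^(2-k) - 4 this exceeds C(P_n) by 2^(2-(n-k)) - 2^(2-n) ≥ 0.
-- Deleting a link of K_m costs at most 2 (1/2 - 1/4) inside K_m, since a third
-- vertex of K_m gives a detour, and is outweighed by the bridge.
module Submission where

open import Defs
open import Data.Nat.Base using (ℕ; _≤_)
open import Data.Integer.Base as ℤ using (+_)
open import Data.Rational.Base using (_/_; _+_; _-_)

open import Algebra.Bundles using (module CommutativeRing)
open import Data.Bool.Base using (Bool; true; false; if_then_else_)
open import Data.Fin.Base using (Fin; zero; suc; toℕ; fromℕ; fromℕ<; _↑ˡ_; _↑ʳ_)
open import Data.Fin.Properties
  using (_≟_; toℕ-injective; toℕ-fromℕ; toℕ-fromℕ<; toℕ<n; toℕ-↑ˡ; toℕ-↑ʳ;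
         ↑ˡ-injective)
import Data.Integer.Properties as ℤ
open import Data.Nat.Base as ℕ using (zero; suc; z≤n; s≤s; ∣_-_∣)
import Data.Nat.Properties as ℕ
open import Data.Product.Base using (∃; _×_; _,_; proj₁; proj₂)
open import Data.Rational.Base as ℚ using (ℚ; 0ℚ; 1ℚ; ½; _*_; -_; fromℚᵘ)
open import Data.Rational.Properties as ℚ
  using (+-0-commutativeMonoid; +-*-commutativeRing)
open import Data.Rational.Solver using (module +-*-Solver)
open import Data.Rational.Unnormalised.Base as ℚᵘ using (mkℚᵘ; *≡*)
import Data.Rational.Unnormalised.Properties as ℚᵘ
open import Data.Sum.Base using (inj₁; inj₂)
open import Function.Base using (_∘_)
open import Relation.Binary.Construct.Closure.Symmetric using (fwd; bwd)
open import Relation.Binary.Definitions using (tri<; tri≈; tri>)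
open import Relation.Binary.PropositionalEquality
open import Relation.Nullary using (¬_; yes; no; does; contradiction)
open import Relation.Nullary.Decidable using (dec-true; _×-dec_)

open import Algebra.Properties.CommutativeMonoid.Sum +-0-commutativeMonoid
  using (sum; sum-cong-≗; sum-replicate-zero; ∑-distrib-+; ∑-comm)
open import Algebra.Properties.Semiring.Exp
  (CommutativeRing.semiring +-*-commutativeRing) using (_^_)
open import Algebra.Properties.Semiring.Sum
  (CommutativeRing.semiring +-*-commutativeRing) using (*-distribˡ-sum)

open +-*-Solver using (solve; con; _:+_; _:*_; _:-_; _:=_)

private
  variable
    k l m n N : ℕ

2ℚ 4ℚ ¼ : ℚ
2ℚ = + 2 / 1
4ℚ = + 4 / 1
¼ = ½ * ½

-- Embedding the integers

-- Arithmetic on `ℚ` normalises its results and does not reduce on variables. It is therefore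
-- transported to unnormalised fractions; since `i / 1` is `fromℚᵘ (mkℚᵘ i 0)`, the laws below
-- become identities between integers.
fromℚᵘ-homo-+ : ∀ p q → fromℚᵘ p + fromℚᵘ q ≡ fromℚᵘ (p ℚᵘ.+ q)
fromℚᵘ-homo-+ p q = ℚ.toℚᵘ-injective
  (ℚᵘ.≃-trans (ℚ.toℚᵘ-homo-+ (fromℚᵘ p) (fromℚᵘ q))
  (ℚᵘ.≃-trans (ℚᵘ.+-cong (ℚ.toℚᵘ-fromℚᵘ p) (ℚ.toℚᵘ-fromℚᵘ q))
              (ℚᵘ.≃-sym (ℚ.toℚᵘ-fromℚᵘ (p ℚᵘ.+ q)))))

fromℚᵘ-homo-* : ∀ p q → fromℚᵘ p * fromℚᵘ q ≡ fromℚᵘ (p ℚᵘ.* q)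
fromℚᵘ-homo-* p q = ℚ.toℚᵘ-injective
  (ℚᵘ.≃-trans (ℚ.toℚᵘ-homo-* (fromℚᵘ p) (fromℚᵘ q))
  (ℚᵘ.≃-trans (ℚᵘ.*-cong (ℚ.toℚᵘ-fromℚᵘ p) (ℚ.toℚᵘ-fromℚᵘ q))
              (ℚᵘ.≃-sym (ℚ.toℚᵘ-fromℚᵘ (p ℚᵘ.* q)))))

/1-homo-+ : ∀ i j → (i ℤ.+ j) / 1 ≡ i / 1 + j / 1
/1-homo-+ i j = sym (trans (fromℚᵘ-homo-+ (mkℚᵘ i 0) (mkℚᵘ j 0))
  (ℚ.fromℚᵘ-cong {mkℚᵘ i 0 ℚᵘ.+ mkℚᵘ j 0} {mkℚᵘ (i ℤ.+ j) 0} (*≡* (cong (ℤ._* + 1)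
    (cong₂ ℤ._+_ (ℤ.*-identityʳ i) (ℤ.*-identityʳ j))))))

/1-homo-* : ∀ i j → (i ℤ.* j) / 1 ≡ i / 1 * (j / 1)
/1-homo-* i j = sym (fromℚᵘ-homo-* (mkℚᵘ i 0) (mkℚᵘ j 0))

/2≡*½ : ∀ i → i / 2 ≡ i / 1 * ½
/2≡*½ i = sym (trans (fromℚᵘ-homo-* (mkℚᵘ i 0) (mkℚᵘ (+ 1) 1))
  (ℚ.fromℚᵘ-cong {mkℚᵘ i 0 ℚᵘ.* mkℚᵘ (+ 1) 1} {mkℚᵘ i 1} (*≡* (cong (ℤ._* + 2) (ℤ.*-identityʳ i)))))

-- Powers of ½

½^-nonNeg : ∀ k → 0ℚ ℚ.≤ ½ ^ k
½^-nonNeg zero    = ℚ.nonNegative⁻¹ 1ℚ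
½^-nonNeg (suc k) = ℚ.*-monoˡ-≤-nonNeg ½ (½^-nonNeg k)

½^≤1 : ∀ k → ½ ^ k ℚ.≤ 1ℚ
½^≤1 zero    = ℚ.≤-refl
½^≤1 (suc k) = ℚ.≤-trans (ℚ.*-monoˡ-≤-nonNeg ½ (½^≤1 k)) (ℚ.≤ᵇ⇒≤ _)

½^-antimono : k ≤ l → ½ ^ l ℚ.≤ ½ ^ k
½^-antimono {l = l} z≤n = ½^≤1 l
½^-antimono (s≤s k≤l)   = ℚ.*-monoˡ-≤-nonNeg ½ (½^-antimono k≤l)

2^-≡½^ : ∀ k → 2^ (ℤ.- + k) ≡ ½ ^ k
2^-≡½^ zero    = refl
2^-≡½^ (suc k) = refl

-- `2^_` splits on the sign of its exponent. At `n = 1` the exponent is positive and both sides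
-- compute to 2; from `n = 2` on it is `-(n - 2)`, which gives a power of `½`.
2^[2-n]≡4*½^n : 1 ≤ n → 2^ (+ 2 ℤ.- + n) ≡ 4ℚ * ½ ^ n
2^[2-n]≡4*½^n {suc zero}    _ = refl
2^[2-n]≡4*½^n {suc (suc n)} _ = begin
  2^ (2 ℤ.⊖ suc (suc n))     ≡⟨ cong 2^_ (ℤ.[1+m]⊖[1+n]≡m⊖n 1 (suc n)) ⟩
  2^ (1 ℤ.⊖ suc n)           ≡⟨ cong 2^_ (ℤ.[1+m]⊖[1+n]≡m⊖n 0 n) ⟩
  2^ (0 ℤ.⊖ n)               ≡⟨ cong 2^_ (ℤ.⊖-≤ {0} {n} z≤n) ⟩
  2^ (ℤ.- + n)               ≡⟨ 2^-≡½^ n ⟩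
  ½ ^ n                      ≡⟨ solve 1 (λ x → x := con 4ℚ :* (con ½ :* (con ½ :* x))) refl (½ ^ n) ⟩
  4ℚ * (½ * (½ * ½ ^ n))     ∎
  where open ≡-Reasoning

-- Finite sums

Σ² : (Fin m → Fin n → ℚ) → ℚ
Σ² f = sum λ i → sum (f i)

sum-mono-≤ : {f g : Fin n → ℚ} → (∀ i → f i ℚ.≤ g i) → sum f ℚ.≤ sum g
sum-mono-≤ {zero}  f≤g = ℚ.≤-refl
sum-mono-≤ {suc n} f≤g = ℚ.+-mono-≤ (f≤g zero) (sum-mono-≤ (f≤g ∘ suc))

sum-nonNeg : {f : Fin n → ℚ} → (∀ i → 0ℚ ℚ.≤ f i) → 0ℚ ℚ.≤ sum f
sum-nonNeg {n} {f} 0≤f = subst (ℚ._≤ sum f) (sum-replicate-zero n) (sum-mono-≤ 0≤f)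

sum-nonPos : {f : Fin n → ℚ} → (∀ i → f i ℚ.≤ 0ℚ) → sum f ℚ.≤ 0ℚ
sum-nonPos {n} {f} f≤0 = subst (sum f ℚ.≤_) (sum-replicate-zero n) (sum-mono-≤ f≤0)

sum-split : ∀ m (f : Fin (m ℕ.+ n) → ℚ) →
            sum f ≡ sum (λ i → f (i ↑ˡ n)) + sum (λ j → f (m ↑ʳ j))
sum-split zero    f = sym (ℚ.+-identityˡ _)
sum-split (suc m) f =
  trans (cong (f zero ℚ.+_) (sum-split m (f ∘ suc))) (sym (ℚ.+-assoc (f zero) _ _))

sum-↑ˡ-≤ : {f : Fin (m ℕ.+ n) → ℚ} → (∀ i → 0ℚ ℚ.≤ f i) →
           sum (λ i → f (i ↑ˡ n)) ℚ.≤ sum f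
sum-↑ˡ-≤ {m} {n} {f} 0≤f = begin
  sum (λ i → f (i ↑ˡ n))                              ≡⟨ ℚ.+-identityʳ _ ⟨
  sum (λ i → f (i ↑ˡ n)) + 0ℚ                         ≤⟨ ℚ.+-monoʳ-≤ (sum (λ i → f (i ↑ˡ n))) (sum-nonNeg (λ j → 0≤f (m ↑ʳ j))) ⟩
  sum (λ i → f (i ↑ˡ n)) + sum (λ j → f (m ↑ʳ j))     ≡⟨ sum-split m f ⟨
  sum f                                               ∎
  where open ℚ.≤-Reasoning

term≤sum : {f : Fin n → ℚ} → (∀ i → 0ℚ ℚ.≤ f i) → ∀ i → f i ℚ.≤ sum f
term≤sum {f = f} 0≤f zero =
  subst (ℚ._≤ sum f) (ℚ.+-identityʳ (f zero)) (ℚ.+-monoʳ-≤ (f zero) (sum-nonNeg (0≤f ∘ suc)))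
term≤sum {f = f} 0≤f (suc i) =
  subst (ℚ._≤ sum f) (ℚ.+-identityˡ (f (suc i))) (ℚ.+-mono-≤ (0≤f zero) (term≤sum (0≤f ∘ suc) i))

term≤Σ² : {f : Fin m → Fin n → ℚ} → (∀ i j → 0ℚ ℚ.≤ f i j) → ∀ i j → f i j ℚ.≤ Σ² f
term≤Σ² 0≤f i j =
  ℚ.≤-trans (term≤sum (0≤f i) j) (term≤sum (λ i → sum-nonNeg (0≤f i)) i)

Σ²-nonNeg : {f : Fin m → Fin n → ℚ} → (∀ i j → 0ℚ ℚ.≤ f i j) → 0ℚ ℚ.≤ Σ² f
Σ²-nonNeg 0≤f = sum-nonNeg λ i → sum-nonNeg (0≤f i)

Σ²-distrib-+ : (f g : Fin m → Fin n → ℚ) → Σ² (λ i j → f i j + g i j) ≡ Σ² f + Σ² g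
Σ²-distrib-+ f g = trans (sum-cong-≗ λ i → ∑-distrib-+ (f i) (g i))
                         (∑-distrib-+ (λ i → sum (f i)) (λ i → sum (g i)))

Σ²-split : ∀ m {n} (f : Fin (m ℕ.+ n) → Fin (m ℕ.+ n) → ℚ) →
           Σ² f ≡ (Σ² (λ i j → f (i ↑ˡ n) (j ↑ˡ n)) + Σ² (λ i j → f (i ↑ˡ n) (m ↑ʳ j)))
                + (Σ² (λ i j → f (m ↑ʳ i) (j ↑ˡ n)) + Σ² (λ i j → f (m ↑ʳ i) (m ↑ʳ j)))
Σ²-split m {n} f = trans (sum-split m (λ i → sum (f i))) (cong₂ _+_ (rows (_↑ˡ n)) (rows (m ↑ʳ_)))
  where
  rows : (e : Fin k → Fin (m ℕ.+ n)) →
         sum (λ i → sum (f (e i))) ≡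
         Σ² (λ i j → f (e i) (j ↑ˡ n)) + Σ² (λ i j → f (e i) (m ↑ʳ j))
  rows e = trans (sum-cong-≗ (λ i → sum-split m (f (e i)))) (∑-distrib-+ (λ i → sum (λ j → f (e i) (j ↑ˡ n))) (λ i → sum (λ j → f (e i) (m ↑ʳ j))))

sum-if : ∀ (c : Bool) (f : Fin n → ℚ) →
         sum (λ i → if c then f i else 0ℚ) ≡ (if c then sum f else 0ℚ)
sum-if     true  f = refl
sum-if {n} false f = sum-replicate-zero n

sum-indicator : ∀ (u : Fin n) x → sum (λ i → if does (i ≟ u) then x else 0ℚ) ≡ x
sum-indicator {suc n} zero    x = trans (cong (x ℚ.+_) (sum-replicate-zero n)) (ℚ.+-identityʳ x)
sum-indicator {suc n} (suc u) x = trans (ℚ.+-identityˡ _) (sum-indicator u x)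

sum-geometric : ∀ n → sum {n} (λ i → ½ ^ toℕ i) ≡ 2ℚ - 2ℚ * ½ ^ n
sum-geometric zero    = refl
sum-geometric (suc n) = begin
  1ℚ + sum {n} (λ i → ½ * ½ ^ toℕ i)
    ≡⟨ cong (1ℚ ℚ.+_) (*-distribˡ-sum ½ (λ (i : Fin n) → ½ ^ toℕ i)) ⟨
  1ℚ + ½ * sum {n} (λ i → ½ ^ toℕ i)
    ≡⟨ cong (λ s → 1ℚ + ½ * s) (sum-geometric n) ⟩
  1ℚ + ½ * (2ℚ - 2ℚ * ½ ^ n)
    ≡⟨ solve 1 (λ x → con 1ℚ :+ con ½ :* (con 2ℚ :- con 2ℚ :* x)
                      := con 2ℚ :- con 2ℚ :* (con ½ :* x)) refl (½ ^ n) ⟩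
  2ℚ - 2ℚ * (½ * ½ ^ n) ∎
  where open ≡-Reasoning

sum-const : ∀ n x → sum {n} (λ _ → x) ≡ + n / 1 * x
sum-const zero    x = sym (ℚ.*-zeroˡ x)
sum-const (suc n) x = begin
  x + sum {n} (λ _ → x)   ≡⟨ cong (x ℚ.+_) (sum-const n x) ⟩
  x + + n / 1 * x         ≡⟨ solve 2 (λ x ν → x :+ ν :* x := (con 1ℚ :+ ν) :* x) refl x (+ n / 1) ⟩
  (1ℚ + + n / 1) * x      ≡⟨ cong (_* x) (/1-homo-+ (+ 1) (+ n)) ⟨
  + suc n / 1 * x         ∎
  where open ≡-Reasoning

-- Closeness of complete graphs and of paths

cliqueTerm pathTerm : Fin n → Fin n → ℚ
cliqueTerm i j = if does (i ≟ j) then 0ℚ else ½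
pathTerm   i j = if does (i ≟ j) then 0ℚ else ½ ^ ∣ toℕ i - toℕ j ∣

-- Both `cliqueTerm` and `pathTerm` at `suc i` and `suc j` reduce to their values at `i` and `j`.
-- Removing the first vertex thus leaves the sum for the smaller graph, which is the induction step
-- of both closed forms.
Σ²-border : (f : Fin (suc n) → Fin (suc n) → ℚ) →
            Σ² f ≡ f zero zero + sum (λ j → f zero (suc j))
                 + (sum (λ i → f (suc i) zero) + Σ² (λ i j → f (suc i) (suc j)))
Σ²-border f = cong (sum (f zero) ℚ.+_) (∑-distrib-+ (λ i → f (suc i) zero) (λ i → sum (λ j → f (suc i) (suc j))))

cliqueSum : ∀ m → Σ² {m} cliqueTerm ≡ (+ m ℤ.* (+ m ℤ.- + 1)) / 2
cliqueSum m = trans (byInduction m) (sym (trans (/2≡*½ (+ m ℤ.* (+ m ℤ.- + 1))) (cong (_* ½)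
  (trans (/1-homo-* (+ m) (+ m ℤ.- + 1)) (cong (+ m / 1 *_) (/1-homo-+ (+ m) (ℤ.- + 1)))))))
  where
  open ≡-Reasoning
  byInduction : ∀ m → Σ² {m} cliqueTerm ≡ + m / 1 * (+ m / 1 - 1ℚ) * ½
  byInduction zero    = refl
  byInduction (suc m) = begin
    Σ² {suc m} cliqueTerm
      ≡⟨ Σ²-border {m} cliqueTerm ⟩
    0ℚ + sum {m} (λ _ → ½) + (sum {m} (λ _ → ½) + Σ² {m} cliqueTerm)
      ≡⟨ cong₂ (λ s t → 0ℚ + s + (s + t)) (sum-const m ½) (byInduction m) ⟩
    0ℚ + ν * ½ + (ν * ½ + ν * (ν - 1ℚ) * ½)
      ≡⟨ solve 1 (λ ν → con 0ℚ :+ ν :* con ½ :+ (ν :* con ½ :+ ν :* (ν :- con 1ℚ) :* con ½)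
                        := (con 1ℚ :+ ν) :* (con 1ℚ :+ ν :- con 1ℚ) :* con ½) refl ν ⟩
    (1ℚ + ν) * (1ℚ + ν - 1ℚ) * ½
      ≡⟨ cong (λ μ → μ * (μ - 1ℚ) * ½) (/1-homo-+ (+ 1) (+ m)) ⟨
    + suc m / 1 * (+ suc m / 1 - 1ℚ) * ½ ∎
    where ν = + m / 1

-- A new end vertex has distances 1, ..., `n` to the old ones. In both directions together it adds
-- twice the geometric sum `1 - ½ ^ n`.
pathSum : ∀ n → Σ² {n} pathTerm ≡ 2ℚ * (+ n / 1) + 4ℚ * ½ ^ n - 4ℚ
pathSum zero    = refl
pathSum (suc n) = begin
  Σ² {suc n} pathTerm
    ≡⟨ Σ²-border {n} pathTerm ⟩
  0ℚ + sum {n} (λ i → ½ * ½ ^ toℕ i) + (sum {n} (λ i → ½ * ½ ^ toℕ i) + Σ² {n} pathTerm)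
    ≡⟨ cong₂ (λ s t → 0ℚ + s + (s + t)) geometric (pathSum n) ⟩
  0ℚ + ½ * (2ℚ - 2ℚ * x) + (½ * (2ℚ - 2ℚ * x) + (2ℚ * ν + 4ℚ * x - 4ℚ))
    ≡⟨ solve 2 (λ ν x → con 0ℚ :+ con ½ :* (con 2ℚ :- con 2ℚ :* x)
                          :+ (con ½ :* (con 2ℚ :- con 2ℚ :* x)
                              :+ (con 2ℚ :* ν :+ con 4ℚ :* x :- con 4ℚ))
                        := con 2ℚ :* (con 1ℚ :+ ν) :+ con 4ℚ :* (con ½ :* x) :- con 4ℚ) refl ν x ⟩
  2ℚ * (1ℚ + ν) + 4ℚ * (½ * x) - 4ℚ
    ≡⟨ cong (λ μ → 2ℚ * μ + 4ℚ * (½ * x) - 4ℚ) (/1-homo-+ (+ 1) (+ n)) ⟨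
  2ℚ * (+ suc n / 1) + 4ℚ * ½ ^ suc n - 4ℚ ∎
  where
  open ≡-Reasoning
  ν = + n / 1
  x = ½ ^ n
  geometric : sum {n} (λ i → ½ * ½ ^ toℕ i) ≡ ½ * (2ℚ - 2ℚ * x)
  geometric = trans (sym (*-distribˡ-sum ½ (λ (i : Fin n) → ½ ^ toℕ i)))
                    (cong (½ *_) (sum-geometric n))

-- Replaces the claimed value by the closenesses of the two pieces left without the bridge, the form
-- in which all later bounds are stated.
closedForm : ∀ m → 1 ≤ n →
  (+ m ℤ.* (+ m ℤ.- + 1)) / 2 + (+ 2 ℤ.* + n) / 1 + 2^ (+ 2 ℤ.- + n) - + 4 / 1
    ≡ Σ² {m} cliqueTerm + Σ² {n} pathTerm
closedForm {n} m 1≤n = begin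
  κ + (+ 2 ℤ.* + n) / 1 + 2^ (+ 2 ℤ.- + n) - 4ℚ
    ≡⟨ cong₂ (λ s t → κ + s + t - 4ℚ) (/1-homo-* (+ 2) (+ n)) (2^[2-n]≡4*½^n 1≤n) ⟩
  κ + 2ℚ * ν + 4ℚ * x - 4ℚ
    ≡⟨ solve 3 (λ κ ν x → κ :+ con 2ℚ :* ν :+ con 4ℚ :* x :- con 4ℚ
                          := κ :+ (con 2ℚ :* ν :+ con 4ℚ :* x :- con 4ℚ)) refl κ ν x ⟩
  κ + (2ℚ * ν + 4ℚ * x - 4ℚ)
    ≡⟨ cong₂ _+_ (cliqueSum m) (pathSum n) ⟨
  Σ² {m} cliqueTerm + Σ² {n} pathTerm ∎
  where
  open ≡-Reasoning
  κ = (+ m ℤ.* (+ m ℤ.- + 1)) / 2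
  ν = + n / 1
  x = ½ ^ n

-- Walks and distances

module _ {N} {G : Graph N} where

  snoc : ∀ {i j k l} → Walk G i j l → Adj G j k → Walk G i k (suc l)
  snoc []       e = e ∷ []
  snoc (e′ ∷ w) e = e′ ∷ snoc w e

  reverse : ∀ {i j l} → Walk G i j l → Walk G j i l
  reverse []      = []
  reverse (e ∷ w) = snoc (reverse w) (adj-sym G e)

  walk-nonEmpty : ∀ {i j l} → i ≢ j → Walk G i j l → 1 ≤ l
  walk-nonEmpty i≢i []      = contradiction refl i≢i
  walk-nonEmpty i≢j (_ ∷ _) = s≤s z≤n

-- The positions `lo`, ..., `hi - 1` form a stretch along which one can walk. The surviving pieces
-- of the tail enter the lower bounds only in this form.
Run : Graph N → ℕ → ℕ → Set
Run G lo hi = ∀ {i j} → lo ≤ toℕ i → toℕ j ℕ.< hi → toℕ j ≡ suc (toℕ i) → Adj G i j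

ascend : ∀ {G : Graph N} {lo hi} → Run G lo hi → ∀ d {i j} →
         toℕ j ≡ d ℕ.+ toℕ i → lo ≤ toℕ i → toℕ j ℕ.< hi → Walk G i j d
ascend run zero    j≡i lo≤i j<hi = subst (λ x → Walk _ x _ 0) (toℕ-injective j≡i) []
ascend {G = G} run (suc d) {i} {j} j≡d+i lo≤i j<hi =
  run lo≤i (ℕ.≤-<-trans i⁺≤j j<hi) i⁺≡ ∷
  ascend run d (trans j≡d+i (trans (sym (ℕ.+-suc d _)) (cong (d ℕ.+_) (sym i⁺≡))))
               (ℕ.≤-trans lo≤i (ℕ.≤-trans (ℕ.n≤1+n _) (ℕ.≤-reflexive (sym i⁺≡)))) j<hi
  where
  suc-i≤j : suc (toℕ i) ≤ toℕ j
  suc-i≤j = subst (suc (toℕ i) ≤_) (sym j≡d+i) (s≤s (ℕ.m≤n+m (toℕ i) d))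
  -- The successor of `i` is a vertex because its position is at most that of `j`.
  i⁺ = fromℕ< (ℕ.≤-<-trans suc-i≤j (toℕ<n j))
  i⁺≡ : toℕ i⁺ ≡ suc (toℕ i)
  i⁺≡ = toℕ-fromℕ< _
  i⁺≤j : toℕ i⁺ ≤ toℕ j
  i⁺≤j = subst (_≤ toℕ j) (sym i⁺≡) suc-i≤j

module _ (G : Graph N) where

  -- The summand of `closeness`: by definition `closeness G` is `Σ² (term G)`, so it can be split
  -- into blocks directly.
  term : Fin N → Fin N → ℚ
  term i j = if does (i ≟ j) then 0ℚ else 2^-distance G i j

  2^-distance-nonNeg : ∀ i j → 0ℚ ℚ.≤ 2^-distance G i j
  2^-distance-nonNeg i j with distance G i j
  ... | inj₁ (d , _) = subst (0ℚ ℚ.≤_) (sym (2^-≡½^ d)) (½^-nonNeg d)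
  ... | inj₂ _       = ℚ.≤-refl

  term-nonNeg : ∀ i j → 0ℚ ℚ.≤ term i j
  term-nonNeg i j with does (i ≟ j)
  ... | true  = ℚ.≤-refl
  ... | false = 2^-distance-nonNeg i j

  term-diagonal : ∀ i → term i i ≡ 0ℚ
  term-diagonal i rewrite dec-true (i ≟ i) refl = refl

  -- Any walk bounds the distance from above, so lower bounds on closeness only require exhibiting
  -- walks, not shortest ones.
  term≥ : ∀ {i j l} → i ≢ j → Walk G i j l → ½ ^ l ℚ.≤ term i j
  term≥ {i} {j} i≢j w with i ≟ j
  ... | yes i≡j = contradiction i≡j i≢j
  ... | no  _ with distance G i j
  ...   | inj₁ (d , _ , d≤) = subst (_ ℚ.≤_) (sym (2^-≡½^ d)) (½^-antimono (d≤ w))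
  ...   | inj₂ ¬w           = contradiction (_ , w) ¬w

  -- If `j` is unreachable from `i`, the premise holds vacuously and the term 0 is still below
  -- `½ ^ l`.
  term≤ : ∀ {i j l} → (∀ {l′} → Walk G i j l′ → l ≤ l′) → term i j ℚ.≤ ½ ^ l
  term≤ {i} {j} {l} l≤ with does (i ≟ j)
  ... | true  = ½^-nonNeg l
  ... | false with distance G i j
  ...   | inj₁ (d , w , _) = subst (ℚ._≤ _) (sym (2^-≡½^ d)) (½^-antimono (l≤ w))
  ...   | inj₂ _           = ½^-nonNeg l

  term-disconnected : ∀ {i j} → ¬ Connected G i j → term i j ℚ.≤ 0ℚ
  term-disconnected {i} {j} ¬w with does (i ≟ j)
  ... | true  = ℚ.≤-refl
  ... | false with distance G i j
  ...   | inj₁ (d , w , _) = contradiction (d , w) ¬w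
  ...   | inj₂ _           = ℚ.≤-refl

  2^-distance-sym : ∀ i j → 2^-distance G i j ≡ 2^-distance G j i
  2^-distance-sym i j with distance G i j | distance G j i
  ... | inj₁ (d , w , d≤) | inj₁ (d′ , w′ , d′≤) =
    cong (λ x → 2^ (ℤ.- + x)) (ℕ.≤-antisym (d≤ (reverse w′)) (d′≤ (reverse w)))
  ... | inj₁ (d , w , _)  | inj₂ ¬w′             = contradiction (d , reverse w) ¬w′
  ... | inj₂ ¬w           | inj₁ (d′ , w′ , _)   = contradiction (d′ , reverse w′) ¬w
  ... | inj₂ _            | inj₂ _               = refl

  term-sym : ∀ i j → term i j ≡ term j i
  term-sym i j with i ≟ j | j ≟ i
  ... | yes _    | yes _    = refl
  ... | yes i≡j  | no j≢i   = contradiction (sym i≡j) j≢i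
  ... | no i≢j   | yes j≡i  = contradiction (sym j≡i) i≢j
  ... | no _     | no _     = 2^-distance-sym i j

  -- Distance is symmetric, so a bound on the block from tail to clique also serves for the block
  -- from clique to tail.
  Σ²-term-swap : (e : Fin m → Fin N) (f : Fin n → Fin N) →
                 Σ² (λ i j → term (e i) (f j)) ≡ Σ² (λ j i → term (f j) (e i))
  Σ²-term-swap e f = trans (∑-comm λ i j → term (e i) (f j))
    (sum-cong-≗ λ j → sum-cong-≗ λ i → term-sym (e i) (f j))

  -- The run itself provides a walk of length `∣ toℕ a - toℕ b ∣` between `e a` and `e b`. Shortcuts
  -- elsewhere in `G` can only raise the terms.
  run⇒pathSum≤ : ∀ {lo hi} → Run G lo hi → ∀ {c s} (e : Fin c → Fin N) →
                 (∀ a → toℕ (e a) ≡ s ℕ.+ toℕ a) → lo ≤ s → s ℕ.+ c ≤ hi →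
                 Σ² {c} pathTerm ℚ.≤ Σ² (λ a b → term (e a) (e b))
  run⇒pathSum≤ {lo} {hi} run {c} {s} e e≡ lo≤s s+c≤hi =
    sum-mono-≤ λ a → sum-mono-≤ λ b → bound a b
    where
    e-injective : ∀ {a b} → e a ≡ e b → a ≡ b
    e-injective {a} {b} ea≡eb = toℕ-injective (ℕ.+-cancelˡ-≡ s _ _
      (trans (sym (e≡ a)) (trans (cong toℕ ea≡eb) (e≡ b))))

    forward : ∀ a b → toℕ a ≤ toℕ b → Walk G (e a) (e b) ∣ toℕ a - toℕ b ∣
    forward a b a≤b = ascend run ∣ toℕ a - toℕ b ∣ eb≡
      (subst (lo ≤_) (sym (e≡ a)) (ℕ.≤-trans lo≤s (ℕ.m≤m+n s _)))
      (ℕ.<-≤-trans (subst (ℕ._< s ℕ.+ c) (sym (e≡ b)) (ℕ.+-monoʳ-< s (toℕ<n b))) s+c≤hi)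
      where
      open ≡-Reasoning
      eb≡ : toℕ (e b) ≡ ∣ toℕ a - toℕ b ∣ ℕ.+ toℕ (e a)
      eb≡ = begin
        toℕ (e b)                                    ≡⟨ e≡ b ⟩
        s ℕ.+ toℕ b                                  ≡⟨ cong (s ℕ.+_) (ℕ.m∸n+n≡m a≤b) ⟨
        s ℕ.+ (toℕ b ℕ.∸ toℕ a ℕ.+ toℕ a)            ≡⟨ cong (λ d → s ℕ.+ (d ℕ.+ toℕ a)) (ℕ.m≤n⇒∣m-n∣≡n∸m a≤b) ⟨
        s ℕ.+ (∣ toℕ a - toℕ b ∣ ℕ.+ toℕ a)          ≡⟨ ℕ.+-assoc s _ _ ⟨
        s ℕ.+ ∣ toℕ a - toℕ b ∣ ℕ.+ toℕ a            ≡⟨ cong (ℕ._+ toℕ a) (ℕ.+-comm s _) ⟩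
        ∣ toℕ a - toℕ b ∣ ℕ.+ s ℕ.+ toℕ a            ≡⟨ ℕ.+-assoc ∣ toℕ a - toℕ b ∣ s _ ⟩
        ∣ toℕ a - toℕ b ∣ ℕ.+ (s ℕ.+ toℕ a)          ≡⟨ cong (∣ toℕ a - toℕ b ∣ ℕ.+_) (e≡ a) ⟨
        ∣ toℕ a - toℕ b ∣ ℕ.+ toℕ (e a)              ∎

    walk : ∀ a b → Walk G (e a) (e b) ∣ toℕ a - toℕ b ∣
    walk a b with ℕ.≤-total (toℕ a) (toℕ b)
    ... | inj₁ a≤b = forward a b a≤b
    ... | inj₂ b≤a = subst (Walk G (e a) (e b)) (ℕ.∣-∣-comm (toℕ b) (toℕ a)) (reverse (forward b a b≤a))

    bound : ∀ a b → pathTerm a b ℚ.≤ term (e a) (e b)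
    bound a b with a ≟ b
    ... | yes _  = term-nonNeg (e a) (e b)
    ... | no a≢b = term≥ (a≢b ∘ e-injective) (walk a b)

-- Deleting a link of a lollipop

-- p and q are 0-based, unlike the arguments of LollipopLink.
Keeps : ∀ m n → Graph (m ℕ.+ n) → ℕ → ℕ → Set
Keeps m n G p q = ∀ {x y} → LollipopLink m (suc (toℕ x)) (suc (toℕ y)) →
                  ¬ (toℕ x ≡ p × toℕ y ≡ q) → Adj G x y

lollipopLink⇒< : ∀ {m p q} → LollipopLink m p q → p ℕ.< q
lollipopLink⇒< (clique p<q _)     = p<q
lollipopLink⇒< (bridge refl refl) = ℕ.≤-refl
lollipopLink⇒< (path _ refl)      = ℕ.≤-refl

-- In 1-based indices, the step out of `v_m` is the bridge and every later step is a link of the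
-- tail.
consecutive : ∀ {x} → m ≤ suc x → LollipopLink m (suc x) (suc (suc x))
consecutive m≤1+x with ℕ.m≤n⇒m<n∨m≡n m≤1+x
... | inj₁ m<1+x = path m<1+x refl
... | inj₂ refl  = bridge refl refl

↑ˡ≢↑ʳ : ∀ {m n} (i : Fin m) (j : Fin n) → i ↑ˡ n ≢ m ↑ʳ j
↑ˡ≢↑ʳ {m} {n} i j eq = ℕ.<⇒≢ (ℕ.<-≤-trans (toℕ<n i) (ℕ.m≤m+n m (toℕ j)))
  (trans (sym (toℕ-↑ˡ i n)) (trans (cong toℕ eq) (toℕ-↑ʳ m j)))

module _ {m n} {G : Graph (m ℕ.+ n)} {p q} (keeps : Keeps m n G p q) where

  cliqueAdj : ∀ (a b : Fin m) → a ≢ b → ¬ (toℕ a ≡ p × toℕ b ≡ q) →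
              ¬ (toℕ b ≡ p × toℕ a ≡ q) → Adj G (a ↑ˡ n) (b ↑ˡ n)
  cliqueAdj a b a≢b ab≢pq ba≢pq with ℕ.<-cmp (toℕ a) (toℕ b)
  ... | tri< a<b _ _ = keeps
    (subst₂ (LollipopLink m) (cong suc (sym (toℕ-↑ˡ a n))) (cong suc (sym (toℕ-↑ˡ b n)))
            (clique (s≤s a<b) (toℕ<n b)))
    (ab≢pq ∘ λ (≡p , ≡q) → trans (sym (toℕ-↑ˡ a n)) ≡p , trans (sym (toℕ-↑ˡ b n)) ≡q)
  ... | tri≈ _ a≡b _ = contradiction (toℕ-injective a≡b) a≢b
  ... | tri> _ _ b<a = adj-sym G (keeps
    (subst₂ (LollipopLink m) (cong suc (sym (toℕ-↑ˡ b n))) (cong suc (sym (toℕ-↑ˡ a n)))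
            (clique (s≤s b<a) (toℕ<n a)))
    (ba≢pq ∘ λ (≡p , ≡q) → trans (sym (toℕ-↑ˡ b n)) ≡p , trans (sym (toℕ-↑ˡ a n)) ≡q))

  -- The bound `m ≤ suc lo` lets a run start at the last clique vertex, whose 0-based position is
  -- `m - 1`, and so include the bridge.
  run : ∀ {lo hi} → m ≤ suc lo → (∀ {x y} → lo ≤ x → y ℕ.< hi → y ≡ suc x → ¬ (x ≡ p × y ≡ q)) →
        Run G lo hi
  run m≤1+lo avoids {i} {j} lo≤i j<hi j≡1+i = keeps
    (subst (λ y → LollipopLink m (suc (toℕ i)) (suc y)) (sym j≡1+i)
           (consecutive (ℕ.≤-trans m≤1+lo (s≤s lo≤i))))
    (avoids lo≤i j<hi j≡1+i)

-- The two geometric sums exactly replace the lost 4 (1 - ½ ^ k).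
pathSum-cut : ∀ k l → Σ² {k ℕ.+ l} pathTerm ℚ.≤
  sum {k} (λ i → ½ ^ toℕ i) + (sum {k} (λ i → ½ ^ toℕ i)
    + ((Σ² {k} pathTerm + 0ℚ) + (0ℚ + Σ² {l} pathTerm)))
pathSum-cut k l = begin
  Σ² {k ℕ.+ l} pathTerm
    ≡⟨ pathSum (k ℕ.+ l) ⟩
  2ℚ * (+ (k ℕ.+ l) / 1) + 4ℚ * ½ ^ (k ℕ.+ l) - 4ℚ
    ≡⟨ cong (λ μ → 2ℚ * μ + 4ℚ * ½ ^ (k ℕ.+ l) - 4ℚ) (/1-homo-+ (+ k) (+ l)) ⟩
  2ℚ * (κ + ν) + 4ℚ * ½ ^ (k ℕ.+ l) - 4ℚ
    ≤⟨ ℚ.+-monoˡ-≤ (- 4ℚ) (ℚ.+-monoʳ-≤ (2ℚ * (κ + ν))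
         (ℚ.*-monoˡ-≤-nonNeg 4ℚ (½^-antimono (ℕ.m≤n+m l k)))) ⟩
  2ℚ * (κ + ν) + 4ℚ * y - 4ℚ
    ≡⟨ solve 4 (λ κ ν x y →
         con 2ℚ :* (κ :+ ν) :+ con 4ℚ :* y :- con 4ℚ :=
         (con 2ℚ :- con 2ℚ :* x) :+ ((con 2ℚ :- con 2ℚ :* x)
           :+ ((con 2ℚ :* κ :+ con 4ℚ :* x :- con 4ℚ :+ con 0ℚ)
           :+ (con 0ℚ :+ (con 2ℚ :* ν :+ con 4ℚ :* y :- con 4ℚ))))) refl κ ν x y ⟩
  (2ℚ - 2ℚ * x) + ((2ℚ - 2ℚ * x)
    + ((2ℚ * κ + 4ℚ * x - 4ℚ + 0ℚ) + (0ℚ + (2ℚ * ν + 4ℚ * y - 4ℚ))))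
    ≡⟨ cong₂ (λ s t → s + (s + t)) (sum-geometric k)
         (cong₂ (λ s t → s + 0ℚ + (0ℚ + t)) (pathSum k) (pathSum l)) ⟨
  sum {k} (λ i → ½ ^ toℕ i) + (sum {k} (λ i → ½ ^ toℕ i)
    + ((Σ² {k} pathTerm + 0ℚ) + (0ℚ + Σ² {l} pathTerm))) ∎
  where
  open ℚ.≤-Reasoning
  κ = + k / 1
  ν = + l / 1
  x = ½ ^ k
  y = ½ ^ l

-- Cutting the bridge or a link of the tail

module _ {m k l} {G : Graph (3 ℕ.+ m ℕ.+ (k ℕ.+ l))} {p}
         (keeps : Keeps (3 ℕ.+ m) (k ℕ.+ l) G p (3 ℕ.+ m ℕ.+ k)) where

  private
    M = 3 ℕ.+ m
    n′ = k ℕ.+ l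

    near : Fin k → Fin (M ℕ.+ n′)
    near a = M ↑ʳ (a ↑ˡ l)

    far : Fin l → Fin (M ℕ.+ n′)
    far b = M ↑ʳ (k ↑ʳ b)

    last : Fin M
    last = suc (suc (fromℕ m))

    toℕ-near : ∀ a → toℕ (near a) ≡ M ℕ.+ toℕ a
    toℕ-near a = trans (toℕ-↑ʳ M _) (cong (M ℕ.+_) (toℕ-↑ˡ a l))

    toℕ-far : ∀ b → toℕ (far b) ≡ M ℕ.+ k ℕ.+ toℕ b
    toℕ-far b = trans (toℕ-↑ʳ M _)
      (trans (cong (M ℕ.+_) (toℕ-↑ʳ k b)) (sym (ℕ.+-assoc M k _)))

    toℕ-last : toℕ (last ↑ˡ n′) ≡ 2 ℕ.+ m
    toℕ-last = trans (toℕ-↑ˡ last n′) (cong (2 ℕ.+_) (toℕ-fromℕ m))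

    -- From the last clique vertex up to just before `q = M + k`: no link of this run ends at `q`.
    nearRun : Run G (2 ℕ.+ m) (M ℕ.+ k)
    nearRun = run {G = G} keeps ℕ.≤-refl λ _ y<q _ (_ , y≡q) → ℕ.<⇒≢ y<q y≡q

    -- From `q` onwards: every link of this run ends strictly beyond `q`.
    farRun : Run G (M ℕ.+ k) (M ℕ.+ n′)
    farRun = run {G = G} keeps (ℕ.m≤n⇒m≤1+n (ℕ.m≤m+n M k))
      λ q≤x _ y≡1+x (_ , y≡q) → ℕ.<⇒≢ (s≤s q≤x) (trans (sym y≡q) y≡1+x)

    cliqueAdj′ : ∀ a b → a ≢ b → Adj G (a ↑ˡ n′) (b ↑ˡ n′)
    cliqueAdj′ a b a≢b = cliqueAdj {G = G} keeps a b a≢b (≢q b ∘ proj₂) (≢q a ∘ proj₂)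
      where
      ≢q : ∀ (c : Fin M) → toℕ c ≢ M ℕ.+ k
      ≢q c = ℕ.<⇒≢ (ℕ.<-≤-trans (toℕ<n c) (ℕ.m≤m+n M k))

    toLast : ∀ a → Walk G (near a) (last ↑ˡ n′) (suc (toℕ a))
    toLast a = reverse (ascend nearRun (suc (toℕ a))
      (trans (toℕ-near a) (trans (ℕ.+-comm M (toℕ a))
        (trans (ℕ.+-suc (toℕ a) (2 ℕ.+ m)) (cong (suc (toℕ a) ℕ.+_) (sym toℕ-last)))))
      (ℕ.≤-reflexive (sym toℕ-last))
      (subst (ℕ._< M ℕ.+ k) (sym (toℕ-near a)) (ℕ.+-monoʳ-< M (toℕ<n a))))

    toOther : ∀ a c → last ≢ c → Walk G (near a) (c ↑ˡ n′) (2 ℕ.+ toℕ a)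
    toOther a c last≢c = snoc (toLast a) (cliqueAdj′ last c last≢c)

    near≢ : ∀ a c → near a ≢ c ↑ˡ n′
    near≢ a c = ↑ˡ≢↑ʳ {M} {n′} c (a ↑ˡ l) ∘ sym

    clique≤ : ∀ a b → cliqueTerm {M} a b ℚ.≤ term G (a ↑ˡ n′) (b ↑ˡ n′)
    clique≤ a b with a ≟ b
    ... | yes _  = term-nonNeg G (a ↑ˡ n′) (b ↑ˡ n′)
    ... | no a≢b = term≥ G (a≢b ∘ ↑ˡ-injective n′ a b) (cliqueAdj′ a b a≢b ∷ [])

    -- Here m ≥ 3 is needed: distances a + 2, a + 2 and a + 1 contribute ½ ^ a in total.
    toClique≤ : ∀ a → ½ ^ toℕ a ℚ.≤ sum {M} λ c → term G (near a) (c ↑ˡ n′)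
    toClique≤ a = begin
      x
        ≡⟨ solve 1 (λ x → x := con ½ :* (con ½ :* x) :+ (con ½ :* (con ½ :* x) :+ con ½ :* x)) refl x ⟩
      ½ * (½ * x) + (½ * (½ * x) + ½ * x)
        ≤⟨ ℚ.+-mono-≤ (term≥ G (near≢ a zero) (toOther a zero λ ()))
          (ℚ.+-mono-≤ (term≥ G (near≢ a (suc zero)) (toOther a (suc zero) λ ()))
            (ℚ.≤-trans (term≥ G (near≢ a last) (toLast a))
              (term≤sum {suc m} {λ c → term G (near a) (suc (suc c) ↑ˡ n′)}
                        (λ c → term-nonNeg G (near a) (suc (suc c) ↑ˡ n′)) (fromℕ m)))) ⟩
      sum {M} (λ c → term G (near a) (c ↑ˡ n′)) ∎
      where
      open ℚ.≤-Reasoning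
      x = ½ ^ toℕ a

    pathToClique≤ : sum {k} (λ a → ½ ^ toℕ a) ℚ.≤
                    Σ² {n′} {M} (λ b c → term G (M ↑ʳ b) (c ↑ˡ n′))
    pathToClique≤ = ℚ.≤-trans (sum-mono-≤ toClique≤)
      -- The rows of the far vertices are dropped, as their terms are nonnegative.
      (sum-↑ˡ-≤ {k} {l} {λ b → sum {M} λ c → term G (M ↑ʳ b) (c ↑ˡ n′)}
        λ b → sum-nonNeg {M} λ c → term-nonNeg G (M ↑ʳ b) (c ↑ˡ n′))

  -- The first `k` tail vertices stay attached to the clique, with `k = 0` when the bridge is cut.
  -- The sum is bounded block by block: `γ` for each direction between clique and tail, path sums
  -- for near and far, and 0 for the two blocks between near and far.
  cut⇒≤closeness : Σ² {M} cliqueTerm + Σ² {n′} pathTerm ℚ.≤ closeness G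
  cut⇒≤closeness = begin
    Σ² {M} cliqueTerm + Σ² {n′} pathTerm
      ≤⟨ ℚ.+-monoʳ-≤ (Σ² {M} cliqueTerm) (pathSum-cut k l) ⟩
    Σ² {M} cliqueTerm + (γ + (γ + ((Σ² {k} pathTerm + 0ℚ) + (0ℚ + Σ² {l} pathTerm))))
      ≡⟨ ℚ.+-assoc (Σ² {M} cliqueTerm) γ _ ⟨
    Σ² {M} cliqueTerm + γ + (γ + ((Σ² {k} pathTerm + 0ℚ) + (0ℚ + Σ² {l} pathTerm)))
      ≤⟨ ℚ.+-mono-≤
           (ℚ.+-mono-≤ (sum-mono-≤ λ a → sum-mono-≤ λ b → clique≤ a b)
                       (subst (γ ℚ.≤_) (Σ²-term-swap G {n′} {M} (M ↑ʳ_) (_↑ˡ n′)) pathToClique≤))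
           (ℚ.+-mono-≤ pathToClique≤
             (ℚ.+-mono-≤
               (ℚ.+-mono-≤ (run⇒pathSum≤ G nearRun near toℕ-near (ℕ.n≤1+n _) ℕ.≤-refl)
                           (Σ²-nonNeg λ a b → term-nonNeg G (near a) (far b)))
               (ℚ.+-mono-≤ (Σ²-nonNeg λ a b → term-nonNeg G (far a) (near b))
                           (run⇒pathSum≤ G farRun far toℕ-far ℕ.≤-refl
                             (ℕ.≤-reflexive (ℕ.+-assoc M k l)))))) ⟩
    LL + LR + (RL + ((Σ² (λ a b → term G (near a) (near b)) + Σ² (λ a b → term G (near a) (far b)))
                  + (Σ² (λ a b → term G (far a) (near b)) + Σ² (λ a b → term G (far a) (far b)))))
      ≡⟨ cong (λ s → LL + LR + (RL + s)) (Σ²-split k (λ i j → term G (M ↑ʳ i) (M ↑ʳ j))) ⟨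
    LL + LR + (RL + Σ² (λ i j → term G (M ↑ʳ i) (M ↑ʳ j)))
      ≡⟨ Σ²-split M (term G) ⟨
    closeness G ∎
    where
    open ℚ.≤-Reasoning
    γ = sum {k} λ a → ½ ^ toℕ a
    LL = Σ² {M} {M} λ i j → term G (i ↑ˡ n′) (j ↑ˡ n′)
    LR = Σ² {M} {n′} λ i j → term G (i ↑ˡ n′) (M ↑ʳ j)
    RL = Σ² {n′} {M} λ i j → term G (M ↑ʳ i) (j ↑ˡ n′)

-- Deleting a link of the clique

third : ∀ (u v : Fin (3 ℕ.+ m)) → ∃ λ w → w ≢ u × w ≢ v
third zero    zero          = suc zero , (λ ()) , λ ()
third zero    (suc zero)    = suc (suc zero) , (λ ()) , λ ()
third zero    (suc (suc _)) = suc zero , (λ ()) , λ ()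
third (suc _) (suc _)       = zero , (λ ()) , λ ()
third (suc zero)    zero    = suc (suc zero) , (λ ()) , λ ()
third (suc (suc _)) zero    = suc zero , (λ ()) , λ ()

-- Bounds the loss `½ - ¼` of the single ordered pair `u`, `v`, written as a matrix so that clique
-- terms can be compared entry by entry. The nested conditionals let the double sum collapse one
-- index at a time.
indicator : Fin n → Fin n → Fin n → Fin n → ℚ
indicator u v a b = if does (a ≟ u) then (if does (b ≟ v) then ¼ else 0ℚ) else 0ℚ

indicator-nonNeg : ∀ (u v a b : Fin n) → 0ℚ ℚ.≤ indicator u v a b
indicator-nonNeg u v a b with does (a ≟ u) | does (b ≟ v)
... | false | _     = ℚ.≤-refl
... | true  | false = ℚ.≤-refl
... | true  | true  = ℚ.≤ᵇ⇒≤ _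

indicator-diagonal : ∀ (u v : Fin n) → indicator u v u v ≡ ¼
indicator-diagonal u v rewrite dec-true (u ≟ u) refl | dec-true (v ≟ v) refl = refl

Σ²-indicator : ∀ (u v : Fin n) → Σ² (indicator u v) ≡ ¼
Σ²-indicator {n} u v = begin
  Σ² (indicator u v)
    ≡⟨ sum-cong-≗ (λ a → sum-if (does (a ≟ u)) (λ b → if does (b ≟ v) then ¼ else 0ℚ)) ⟩
  sum {n} (λ a → if does (a ≟ u) then sum {n} (λ b → if does (b ≟ v) then ¼ else 0ℚ) else 0ℚ)
    ≡⟨ sum-indicator u _ ⟩
  sum {n} (λ b → if does (b ≟ v) then ¼ else 0ℚ)
    ≡⟨ sum-indicator v ¼ ⟩
  ¼ ∎
  where open ≡-Reasoning

module _ {m n} {G : Graph (3 ℕ.+ m ℕ.+ suc n)} {u v : Fin (3 ℕ.+ m)} (u<v : toℕ u ℕ.< toℕ v)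
         (keeps : Keeps (3 ℕ.+ m) (suc n) G (toℕ u) (toℕ v)) where

  private
    M = 3 ℕ.+ m
    n′ = suc n

    last : Fin M
    last = suc (suc (fromℕ m))

    toℕ-last : toℕ (last ↑ˡ n′) ≡ 2 ℕ.+ m
    toℕ-last = trans (toℕ-↑ˡ last n′) (cong (2 ℕ.+_) (toℕ-fromℕ m))

    pathRun : Run G (2 ℕ.+ m) (M ℕ.+ n′)
    -- A link of this run ends at position at least `M`, whereas `v` lies in the clique.
    pathRun = run {G = G} keeps ℕ.≤-refl λ { M≤1+x _ refl (_ , 1+x≡v) →
      ℕ.<⇒≢ (ℕ.<-≤-trans (toℕ<n v) (s≤s M≤1+x)) (sym 1+x≡v) }

    defect : Fin M → Fin M → ℚ
    defect a b = indicator u v a b + indicator v u a b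

    defect-nonNeg : ∀ a b → 0ℚ ℚ.≤ defect a b
    defect-nonNeg a b = ℚ.+-mono-≤ (indicator-nonNeg u v a b) (indicator-nonNeg v u a b)

    cliqueAdj′ : ∀ a b → a ≢ b → ¬ (a ≡ u × b ≡ v) → ¬ (b ≡ u × a ≡ v) →
                 Adj G (a ↑ˡ n′) (b ↑ˡ n′)
    cliqueAdj′ a b a≢b ab≢uv ba≢uv = cliqueAdj {G = G} keeps a b a≢b
      (λ (a≡u , b≡v) → ab≢uv (toℕ-injective a≡u , toℕ-injective b≡v))
      (λ (b≡u , a≡v) → ba≢uv (toℕ-injective b≡u , toℕ-injective a≡v))

    -- A third clique vertex is still linked to both `u` and `v`; its existence is where this case
    -- uses that the clique has at least three vertices.
    detour : Walk G (u ↑ˡ n′) (v ↑ˡ n′) 2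
    detour with third u v
    ... | w , w≢u , w≢v =
      cliqueAdj′ u w (w≢u ∘ sym) (w≢v ∘ proj₂) (w≢u ∘ proj₁) ∷
      cliqueAdj′ w v w≢v (w≢u ∘ proj₁) (w≢v ∘ proj₂) ∷ []

    T : Fin M → Fin M → ℚ
    T a b = term G (a ↑ˡ n′) (b ↑ˡ n′)

    ↑ˡ≢ : ∀ {a b : Fin M} → a ≢ b → a ↑ˡ n′ ≢ b ↑ˡ n′
    ↑ˡ≢ {a} {b} a≢b = a≢b ∘ ↑ˡ-injective n′ a b

    -- For the deleted pair, in either order, the detour gives `½ ^ 2` and the defect the missing
    -- `¼`; every other pair is still adjacent. The sums of constants on the left all compute to
    -- `½`.
    ½≤ : ∀ a b → a ≢ b → ½ ℚ.≤ T a b + defect a b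
    ½≤ a b a≢b with (a ≟ u ×-dec b ≟ v) | (b ≟ u ×-dec a ≟ v)
    ... | yes (refl , refl) | _ = begin
      ¼ + (¼ + 0ℚ)                                    ≡⟨ cong (λ s → ¼ + (s + 0ℚ)) (indicator-diagonal u v) ⟨
      ¼ + (indicator u v u v + 0ℚ)                    ≤⟨ ℚ.+-mono-≤ (term≥ G (↑ˡ≢ a≢b) detour)
                                                          (ℚ.+-monoʳ-≤ (indicator u v u v) (indicator-nonNeg v u u v)) ⟩
      T u v + defect u v                              ∎
      where open ℚ.≤-Reasoning
    ... | no _ | yes (refl , refl) = begin
      ¼ + (0ℚ + ¼)                                    ≡⟨ cong (λ s → ¼ + (0ℚ + s)) (indicator-diagonal v u) ⟨
      ¼ + (0ℚ + indicator v u v u)                    ≤⟨ ℚ.+-mono-≤ (term≥ G (↑ˡ≢ a≢b) (reverse detour))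
                                                          (ℚ.+-monoˡ-≤ (indicator v u v u) (indicator-nonNeg u v v u)) ⟩
      T v u + defect v u                              ∎
      where open ℚ.≤-Reasoning
    ... | no ab≢uv | no ba≢uv =
      ℚ.+-mono-≤ (term≥ G (↑ˡ≢ a≢b) (cliqueAdj′ a b a≢b ab≢uv ba≢uv ∷ [])) (defect-nonNeg a b)

    clique≤ : ∀ a b → cliqueTerm {M} a b ℚ.≤ T a b + defect a b
    clique≤ a b with a ≟ b
    ... | yes _  = ℚ.+-mono-≤ (term-nonNeg G (a ↑ˡ n′) (b ↑ˡ n′)) (defect-nonNeg a b)
    ... | no a≢b = ½≤ a b a≢b

    -- The bridge, counted in one direction only, already pays for the total defect `¼ + ¼`.
    bridge≤ : ½ ℚ.≤ Σ² {M} {n′} λ i j → term G (i ↑ˡ n′) (M ↑ʳ j)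
    bridge≤ = ℚ.≤-trans
      (term≥ G (↑ˡ≢↑ʳ {M} {n′} last zero) (ascend pathRun 1
        (trans (toℕ-↑ʳ M zero) (trans (ℕ.+-identityʳ M) (cong suc (sym toℕ-last))))
        (ℕ.≤-reflexive (sym toℕ-last)) (toℕ<n (M ↑ʳ zero))))
      (term≤Σ² {M} {n′} (λ i j → term-nonNeg G (i ↑ˡ n′) (M ↑ʳ j)) last zero)

  clique⇒≤closeness : Σ² {M} cliqueTerm + Σ² {n′} pathTerm ℚ.≤ closeness G
  clique⇒≤closeness = begin
    Σ² {M} cliqueTerm + π
      ≤⟨ ℚ.+-monoˡ-≤ π (sum-mono-≤ λ a → sum-mono-≤ λ b → clique≤ a b) ⟩
    Σ² (λ a b → T a b + defect a b) + π
      ≡⟨ cong (ℚ._+ π) (Σ²-distrib-+ T defect) ⟩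
    Σ² T + Σ² defect + π
      ≡⟨ cong (λ s → Σ² T + s + π) (trans (Σ²-distrib-+ (indicator u v) (indicator v u))
           (cong₂ ℚ._+_ (Σ²-indicator u v) (Σ²-indicator v u))) ⟩
    Σ² T + ½ + π
      ≡⟨ cong (Σ² T + ½ ℚ.+_) (ℚ.+-identityˡ π) ⟨
    Σ² T + ½ + (0ℚ + π)
      ≤⟨ ℚ.+-mono-≤ (ℚ.+-monoʳ-≤ (Σ² T) bridge≤)
           (ℚ.+-mono-≤ (Σ²-nonNeg {n′} {M} λ i j → term-nonNeg G (M ↑ʳ i) (j ↑ˡ n′))
             (run⇒pathSum≤ G pathRun (M ↑ʳ_) (toℕ-↑ʳ M) (ℕ.n≤1+n _) ℕ.≤-refl)) ⟩
    Σ² T + Σ² {M} {n′} (λ i j → term G (i ↑ˡ n′) (M ↑ʳ j))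
      + (Σ² {n′} {M} (λ i j → term G (M ↑ʳ i) (j ↑ˡ n′)) + Σ² {n′} (λ i j → term G (M ↑ʳ i) (M ↑ʳ j)))
      ≡⟨ Σ²-split M (term G) ⟨
    closeness G ∎
    where
    open ℚ.≤-Reasoning
    π = Σ² {n′} pathTerm

-- The lower bound for an arbitrary deleted link

lollipop⇒≤closeness : ∀ {G : Graph (3 ℕ.+ m ℕ.+ suc n)} {p q} →
  LollipopLink (3 ℕ.+ m) (suc p) (suc q) → q ℕ.< 3 ℕ.+ m ℕ.+ suc n →
  Keeps (3 ℕ.+ m) (suc n) G p q →
  Σ² {3 ℕ.+ m} cliqueTerm + Σ² {suc n} pathTerm ℚ.≤ closeness G
-- The upper end `q` decides the case: below `3 + m` it forces `p` into the clique as well, since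
-- `p < q`; otherwise `q = 3 + m + k`, and `l` is the number of tail vertices from `q` on.
lollipop⇒≤closeness {m} {n} {G} {p} {q} link q<N keeps with ℕ.<-≤-connex q (3 ℕ.+ m)
... | inj₁ q<M = clique⇒≤closeness {m} {n} {G} {fromℕ< p<M} {fromℕ< q<M}
    (subst₂ ℕ._<_ (sym (toℕ-fromℕ< p<M)) (sym (toℕ-fromℕ< q<M)) p<q)
    (subst₂ (Keeps (3 ℕ.+ m) (suc n) G) (sym (toℕ-fromℕ< p<M)) (sym (toℕ-fromℕ< q<M)) keeps)
  where
  p<q = ℕ.s<s⁻¹ (lollipopLink⇒< link)
  p<M = ℕ.<-trans p<q q<M
... | inj₂ M≤q with ℕ.m≤n⇒∃[o]m+o≡n M≤q
...   | k , refl with ℕ.m≤n⇒∃[o]m+o≡n (ℕ.<⇒≤ (ℕ.+-cancelˡ-< (3 ℕ.+ m) k (suc n) q<N))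
...     | l , k+l≡n = cut k+l≡n G keeps
  where
  -- The type of `G` depends on the tail length, so `suc n` is generalised to a variable before the
  -- equation is matched with `refl`.
  cut : ∀ {l n} → k ℕ.+ l ≡ n → (G : Graph (3 ℕ.+ m ℕ.+ n)) →
        Keeps (3 ℕ.+ m) n G p (3 ℕ.+ m ℕ.+ k) →
        Σ² {3 ℕ.+ m} cliqueTerm + Σ² {n} pathTerm ℚ.≤ closeness G
  cut refl G keeps = cut⇒≤closeness {m} {k} {_} {G} keeps

-- `deleteLink` removes both orientations, but a `LollipopLink` always ascends, so the reversed pair
-- cannot be one.
keeps-deleteLink : ∀ {m n u v} → LollipopLink m (suc (toℕ u)) (suc (toℕ v)) →
  Keeps m n (deleteLink (lollipop m n) u v) (toℕ u) (toℕ v)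
keeps-deleteLink uv xy xy≢uv = fwd xy , λ
  { (inj₁ (x≡u , y≡v)) → xy≢uv (cong toℕ x≡u , cong toℕ y≡v)
  ; (inj₂ (refl , refl)) → ℕ.<-asym (lollipopLink⇒< uv) (lollipopLink⇒< xy) }

keeps-deleteLinkʳ : ∀ {m n u v} → LollipopLink m (suc (toℕ u)) (suc (toℕ v)) →
  Keeps m n (deleteLink (lollipop m n) v u) (toℕ u) (toℕ v)
keeps-deleteLinkʳ uv xy xy≢uv = fwd xy , λ
  { (inj₁ (refl , refl)) → ℕ.<-asym (lollipopLink⇒< uv) (lollipopLink⇒< xy)
  ; (inj₂ (y≡v , x≡u)) → xy≢uv (cong toℕ x≡u , cong toℕ y≡v) }

-- Deleting the bridge

∣n-1+n∣≡1 : ∀ n → ∣ n - suc n ∣ ≡ 1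
∣n-1+n∣≡1 zero    = refl
∣n-1+n∣≡1 (suc n) = ∣n-1+n∣≡1 n

module _ (m n : ℕ) where

  private
    M = suc m
    n′ = suc n
    u v : Fin (M ℕ.+ n′)
    u = fromℕ m ↑ˡ n′
    v = M ↑ʳ zero
    G = deleteLink (lollipop M n′) u v

    toℕ-u : toℕ u ≡ m
    toℕ-u = trans (toℕ-↑ˡ (fromℕ m) n′) (toℕ-fromℕ m)

    toℕ-v : toℕ v ≡ M
    toℕ-v = trans (toℕ-↑ʳ M zero) (ℕ.+-identityʳ M)

  bridgeAdj : Adj (lollipop M n′) u v
  bridgeAdj = fwd (bridge (cong suc toℕ-u) (cong suc toℕ-v))

  -- Without the bridge the tail is closed under adjacency, and each step changes the position by at
  -- most 1. Along walks this yields both the separation from the clique and the lower bound on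
  -- distances within the tail.
  step : ∀ {x y} → Adj G x y → M ≤ toℕ x → M ≤ toℕ y × ∣ toℕ x - toℕ y ∣ ≤ 1
  step (fwd (clique x<y y≤M) , _) M≤x =
    contradiction M≤x (ℕ.<⇒≱ (ℕ.<-≤-trans (ℕ.n<1+n _) (ℕ.≤-trans (ℕ.<⇒≤ x<y) y≤M)))
  step (fwd (bridge 1+x≡M _) , _) M≤x = contradiction (sym 1+x≡M) (ℕ.<⇒≢ (s≤s M≤x))
  step {x} (fwd (path _ 1+y≡2+x) , _) M≤x with ℕ.suc-injective 1+y≡2+x
  ... | y≡1+x = ℕ.≤-trans M≤x (ℕ.≤-trans (ℕ.n≤1+n _) (ℕ.≤-reflexive (sym y≡1+x)))
              , ℕ.≤-reflexive (trans (cong ∣ toℕ x -_∣ y≡1+x) (∣n-1+n∣≡1 (toℕ x)))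
  step (bwd (clique y<x x≤M) , _) M≤x = contradiction M≤x (ℕ.<⇒≱ x≤M)
  -- The only link of the lollipop that leaves the tail is the deleted one.
  step (bwd (bridge 1+y≡M 1+x≡1+M) , kept) M≤x = contradiction
    (inj₂ ( toℕ-injective (trans (ℕ.suc-injective 1+y≡M) (sym toℕ-u))
          , toℕ-injective (trans (ℕ.suc-injective 1+x≡1+M) (sym toℕ-v)))) kept
  step {y = y} (bwd (path M<1+y 1+x≡2+y) , _) M≤x =
    ℕ.s≤s⁻¹ M<1+y , ℕ.≤-reflexive
      (trans (cong (λ x → ∣ x - toℕ y ∣) (ℕ.suc-injective 1+x≡2+y))
             (trans (ℕ.∣-∣-comm (suc (toℕ y)) (toℕ y)) (∣n-1+n∣≡1 (toℕ y))))

  walk⇒∣-∣≤ : ∀ {x y l} → Walk G x y l → M ≤ toℕ x → M ≤ toℕ y × ∣ toℕ x - toℕ y ∣ ≤ l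
  walk⇒∣-∣≤ {x} []          M≤x = M≤x , ℕ.≤-reflexive (ℕ.∣n-n∣≡0 (toℕ x))
  walk⇒∣-∣≤ {x} {z} (_∷_ {j = y} e w) M≤x with step e M≤x
  ... | M≤y , xy≤1 with walk⇒∣-∣≤ w M≤y
  ...   | M≤z , yz≤l = M≤z , ℕ.≤-trans (ℕ.∣-∣-triangle (toℕ x) (toℕ y) (toℕ z)) (ℕ.+-mono-≤ xy≤1 yz≤l)

  M≤↑ʳ : ∀ (b : Fin n′) → M ≤ toℕ (M ↑ʳ b)
  M≤↑ʳ b = subst (M ≤_) (sym (toℕ-↑ʳ M b)) (ℕ.m≤m+n M (toℕ b))

  separated : ∀ (a : Fin M) (b : Fin n′) → ¬ Connected G (M ↑ʳ b) (a ↑ˡ n′)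
  separated a b (_ , w) = ℕ.<⇒≱ (toℕ<n a)
    (subst (M ≤_) (toℕ-↑ˡ a n′) (proj₁ (walk⇒∣-∣≤ w (M≤↑ʳ b))))

  ≤cliqueTerm : ∀ (a b : Fin M) → term G (a ↑ˡ n′) (b ↑ˡ n′) ℚ.≤ cliqueTerm a b
  ≤cliqueTerm a b with a ≟ b
  ... | yes refl = ℚ.≤-reflexive (term-diagonal G (a ↑ˡ n′))
  ... | no a≢b   = term≤ G {l = 1} (walk-nonEmpty (a≢b ∘ ↑ˡ-injective n′ a b))

  ≤pathTerm : ∀ (a b : Fin n′) → term G (M ↑ʳ a) (M ↑ʳ b) ℚ.≤ pathTerm a b
  ≤pathTerm a b with a ≟ b
  ... | yes refl = ℚ.≤-reflexive (term-diagonal G (M ↑ʳ a))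
  ... | no _     = term≤ G λ w → subst (_≤ _)
    (trans (cong₂ ∣_-_∣ (toℕ-↑ʳ M a) (toℕ-↑ʳ M b)) (ℕ.∣m+n-m+o∣≡∣n-o∣ M (toℕ a) (toℕ b)))
    (proj₂ (walk⇒∣-∣≤ w (M≤↑ʳ a)))

  closeness≤ : closeness G ℚ.≤ Σ² {M} cliqueTerm + Σ² {n′} pathTerm
  closeness≤ = begin
    closeness G
      ≡⟨ Σ²-split M (term G) ⟩
    Σ² {M} {M} (λ i j → term G (i ↑ˡ n′) (j ↑ˡ n′)) + Σ² {M} {n′} (λ i j → term G (i ↑ˡ n′) (M ↑ʳ j))
      + (Σ² {n′} {M} (λ i j → term G (M ↑ʳ i) (j ↑ˡ n′)) + Σ² {n′} (λ i j → term G (M ↑ʳ i) (M ↑ʳ j)))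
      ≤⟨ ℚ.+-mono-≤
           (ℚ.+-mono-≤ (sum-mono-≤ λ a → sum-mono-≤ λ b → ≤cliqueTerm a b)
             (sum-nonPos λ a → sum-nonPos λ b → term-disconnected G λ (_ , w) → separated a b (_ , reverse w)))
           (ℚ.+-mono-≤ (sum-nonPos λ b → sum-nonPos λ a → term-disconnected G (separated a b))
             (sum-mono-≤ λ a → sum-mono-≤ λ b → ≤pathTerm a b)) ⟩
    Σ² {M} cliqueTerm + 0ℚ + (0ℚ + Σ² {n′} pathTerm)
      ≡⟨ cong₂ ℚ._+_ (ℚ.+-identityʳ (Σ² {M} cliqueTerm)) (ℚ.+-identityˡ (Σ² {n′} pathTerm)) ⟩
    Σ² {M} cliqueTerm + Σ² {n′} pathTerm ∎
    where open ℚ.≤-Reasoning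

theorem3 : (m n : ℕ) → 3 ≤ m → 1 ≤ n →
    IsLinkResidualCloseness (lollipop m n)
    ((+ m ℤ.* (+ m ℤ.- + 1)) / 2 + (+ 2 ℤ.* + n) / 1 + 2^ (+ 2 ℤ.- + n) - + 4 / 1)
theorem3 (suc (suc (suc m))) (suc n) (s≤s (s≤s (s≤s _))) 1≤n =
  subst (IsLinkResidualCloseness (lollipop M (suc n))) (sym (closedForm M 1≤n))
    -- The minimum is attained at the bridge: `minimal` applied to the bridge itself gives one
    -- inequality and `closeness≤` the other. Both bridge lemmas take the clique size minus one,
    -- hence `2 ℕ.+ m`.
    ( (u , v , bridgeAdj (2 ℕ.+ m) n , ℚ.≤-antisym (minimal u v (bridgeAdj (2 ℕ.+ m) n)) (closeness≤ (2 ℕ.+ m) n))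
    , minimal )
  where
  M = 3 ℕ.+ m
  u = fromℕ (2 ℕ.+ m) ↑ˡ suc n
  v = M ↑ʳ zero
  minimal : ∀ u v → Adj (lollipop M (suc n)) u v →
            Σ² {M} cliqueTerm + Σ² {suc n} pathTerm ℚ.≤ closeness (deleteLink (lollipop M (suc n)) u v)
  minimal u v (fwd uv) = lollipop⇒≤closeness {m} {n} {deleteLink (lollipop M (suc n)) u v} uv (toℕ<n v) (keeps-deleteLink uv)
  minimal u v (bwd vu) = lollipop⇒≤closeness {m} {n} {deleteLink (lollipop M (suc n)) u v} vu (toℕ<n u) (keeps-deleteLinkʳ vu)
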